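{- Let $G$ be a graph on $n \geq 1$ vertices. For any natural number $k > 5n^2$, the colouring graph $\mathcal{C}_k(G)$ uniquely determines $G$ up to isomorphism; that is, for every graph $G'$ with $\mathcal{C}_k(G') \cong \mathcal{C}_k(G)$ we have $G' \cong G$.
   Context: All graphs are finite and simple, with at least one vertex. For a positive integer $k$, a $k$-colouring of a graph $G$ is a proper colouring $c\colon V(G)\to [k]=\{1,\dots,k\}$, i.e. $c(u)\neq c(v)$ whenever $uv\in E(G)$ (not all $k$ colours need be used). The $k$-colouring graph $\mathcal{C}_k(G)$ has as vertices the $k$-colourings of $G$, with an edge between two $k$-colourings if and only if they differ at precisely one vertex of $G$. -}

module Defs where

open import Data.Nat using (ℕ)
open import Data.Fin using (Fin)
open import Data.Fin.Properties using (any?; all?; _≟_)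
open import Data.Product using (∃!; _,_)
open import Data.Vec using (Vec; lookup)
open import Function using (_∘_)
open import Function.Bundles using (_⇔_; _↔_; Inverse)
open import Relation.Binary.Definitions using (Decidable; Symmetric)
open import Relation.Binary.PropositionalEquality using (_≡_; _≢_; refl; sym)
open import Relation.Nullary using (¬_; Dec; ¬?; _×-dec_; _→-dec_)
open import Relation.Nullary.Decidable using (map′)

-- Decidability of adjacency is automatic classically, for finite graphs; it is
-- data here because the setting is constructive.
record Graph (V : Set) : Set₁ where
  field
    Adj        : V → V → Set
    adj?       : Decidable Adj
    adj-sym    : Symmetric Adj
    adj-irrefl : ∀ {v} → ¬ Adj v v

open Graph public

infix 4 _≅_

record _≅_ {V W : Set} (G : Graph V) (H : Graph W) : Set where
  field
    bijection : V ↔ W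
    adjacency : ∀ u v →
      Adj G u v ⇔ Adj H (Inverse.to bijection u) (Inverse.to bijection v)

-- Colours are 0, …, k-1 instead of 1, …, k.  A vector of colours together with
-- an irrelevant properness proof makes _≡_ on colourings coincide with equality
-- of the underlying colour assignments, without function extensionality.
record Colouring {n : ℕ} (k : ℕ) (G : Graph (Fin n)) : Set where
  constructor mkColouring
  field
    colours : Vec (Fin k) n
    .proper : ∀ {u v} → Adj G u v → lookup colours u ≢ lookup colours v

  colour : Fin n → Fin k
  colour = lookup colours

open Colouring public using (colours; colour)

module _ {n k : ℕ} {G : Graph (Fin n)} where

  DifferAt : Colouring k G → Colouring k G → Fin n → Set
  DifferAt c d v = colour c v ≢ colour d v

  DifferAtExactlyOne : Colouring k G → Colouring k G → Set
  DifferAtExactlyOne c d = ∃! _≡_ (DifferAt c d)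

  differAt? : ∀ c d v → Dec (DifferAt c d v)
  differAt? c d v = ¬? (colour c v ≟ colour d v)

  differAtExactlyOne? : Decidable DifferAtExactlyOne
  differAtExactlyOne? c d =
    map′ (λ (v , p , q) → v , p , λ {u} → q u)
         (λ (v , p , q) → v , p , λ u → q {u})
         (any? λ v → differAt? c d v ×-dec all? λ u → differAt? c d u →-dec v ≟ u)

𝒞 : {n : ℕ} (k : ℕ) (G : Graph (Fin n)) → Graph (Colouring k G)
𝒞 k G = record
  { Adj        = DifferAtExactlyOne
  ; adj?       = differAtExactlyOne?
  ; adj-sym    = λ (v , p , q) → v , p ∘ sym , λ r → q (r ∘ sym)
  ; adj-irrefl = λ (_ , p , _) → p refl
  }

{-# OPTIONS --safe #-}

-- Fix a colouring c and a colour a unused by c, and let x v be c with v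
-- recoloured to a.  Two neighbours of c are equal or adjacent exactly when they
-- recolour the same vertex, so vertices correspond to the cliques around c.  For
-- u ≢ v, the only other possible common neighbour of x u and x v is c with both
-- u and v recoloured to a, which is proper just when u and v are not adjacent.
-- An isomorphism of colouring graphs therefore induces a graph isomorphism at c
-- as soon as k exceeds both orders.  That k > n' follows from distances: any two
-- colourings of G are joined by a walk of length 2n through a colouring with
-- fresh colours, while a colouring of G' and its cyclic shift are at distance at
-- least n'.
module Submission where

open import Defs
open import Data.Nat using (ℕ; zero; suc; _+_; _*_; _^_; _≤_; _<_; _>_; _≥_; s≤s; z≤n)
open import Data.Nat.Properties
  using (≤-reflexive; ≤-trans; ≤-<-trans; <⇒≤; <⇒≱; m≤n⇒m≤1+n; m≤m+n; m≤n+m; m≤m*n;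
         +-suc; +-identityʳ; +-monoʳ-≤; *-monoˡ-≤; *-monoʳ-≤; 1+n≢n; module ≤-Reasoning)
open import Data.Fin using (Fin; zero; suc; inject₁; fromℕ; toℕ)
open import Data.Fin.Properties
  using (_≟_; any?; injective⇒≤; toℕ-inject₁; fromℕ≢inject₁; inject₁-injective)
open import Data.List using (List; []; _∷_; _++_; length; allFin; tabulate; lookup)
open import Data.List.Membership.Propositional using (_∈_; _∉_)
open import Data.List.Membership.DecPropositional using (_∈?_)
open import Data.List.Membership.Propositional.Properties
  using (∈-allFin; ∈-tabulate⁺; ∈-++⁺ˡ; ∈-++⁺ʳ)
open import Data.List.Properties using (length-++; length-tabulate)
open import Data.List.Relation.Unary.Any using (here; there; index)
open import Data.List.Relation.Unary.Any.Properties using (lookup-index)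
open import Data.Product using (∃; ∃-syntax; _×_; _,_; proj₁; proj₂)
open import Data.Vec using (_[_]≔_) renaming (lookup to lookupᵛ; tabulate to tabulateᵛ)
open import Data.Vec.Properties using (lookup∘tabulate; lookup∘update; lookup∘update′)
open import Data.Vec.Relation.Binary.Pointwise.Extensional using (ext; Pointwise-≡⇒≡)
open import Function using (_∘_)
open import Function.Bundles using (Inverse; Equivalence; mk⇔; mk↔ₛ′)
open import Function.Construct.Symmetry using (↔-sym)
open import Function.Definitions using (Injective)
open import Relation.Binary.PropositionalEquality
  using (_≡_; _≢_; refl; sym; trans; cong; cong₂; subst; subst₂)
open import Relation.Nullary using (¬_; yes; no; contradiction; ¬?)
open import Relation.Nullary.Recomputable using (¬-recompute)
open import Relation.Nullary.Decidable using (decidable-stable)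

open Inverse using (to; from; strictlyInverseˡ; strictlyInverseʳ)

private
  variable
    k m n : ℕ

≅-sym : {V W : Set} {G : Graph V} {H : Graph W} → G ≅ H → H ≅ G
≅-sym {H = H} φ = record
  { bijection = ↔-sym f
  ; adjacency = λ u v → mk⇔
      (Equivalence.from (adjacency _ _) ∘
        subst₂ (Adj H) (sym (strictlyInverseˡ f u)) (sym (strictlyInverseˡ f v)))
      (subst₂ (Adj H) (strictlyInverseˡ f u) (strictlyInverseˡ f v) ∘
        Equivalence.to (adjacency _ _))
  }
  where open _≅_ φ renaming (bijection to f)

-- Finite sets

-- Sending an element to a position where it occurs is injective, since looking up that position
-- returns the element.
covering⇒≤length : (xs : List (Fin n)) → (∀ v → v ∈ xs) → n ≤ length xs
covering⇒≤length xs all∈ = injective⇒≤ {f = index ∘ all∈} λ {u} {v} eq →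
  trans (lookup-index (all∈ u))
        (trans (cong (lookup xs) eq) (sym (lookup-index (all∈ v))))

fresh : (xs : List (Fin k)) → length xs < k → ∃[ a ] a ∉ xs
fresh xs short with any? (λ a → ¬? (_∈?_ _≟_ a xs))
... | yes p = p
... | no ¬p = contradiction (covering⇒≤length xs all∈) (<⇒≱ short)
  where
  all∈ : ∀ a → a ∈ xs
  all∈ a = decidable-stable (_∈?_ _≟_ a xs) λ a∉ → ¬p (a , a∉)

-- Greedy choice: each chosen value joins the avoided list, so the recursion keeps `m + length xs`
-- constant.
freshInjection : ∀ m (xs : List (Fin k)) → m + length xs ≤ k →
  ∃[ f ] Injective {A = Fin m} _≡_ _≡_ f × (∀ i → f i ∉ xs)
freshInjection zero xs le = (λ ()) , (λ { {()} }) , λ ()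
freshInjection {k} (suc m) xs le
  with a , a∉ ← fresh xs (≤-trans (s≤s (m≤n+m _ m)) le)
  with f , inj , avoid ← freshInjection m (a ∷ xs) (≤-trans (≤-reflexive (+-suc m _)) le)
  = f′ , inj′ , avoid′
  where
  f′ : Fin (suc m) → Fin k
  f′ zero    = a
  f′ (suc i) = f i
  inj′ : Injective _≡_ _≡_ f′
  inj′ {zero}  {zero}  _  = refl
  inj′ {zero}  {suc j} eq = contradiction (here (sym eq)) (avoid j)
  inj′ {suc i} {zero}  eq = contradiction (here eq) (avoid i)
  inj′ {suc i} {suc j} eq = cong suc (inj eq)
  avoid′ : ∀ i → f′ i ∉ xs
  avoid′ zero    = a∉
  avoid′ (suc i) = avoid i ∘ there

-- The cyclic shift `i - 1`: zero goes to the last element, which is not zero because there are at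
-- least two.
derangement : 2 ≤ k → ∃[ f ] Injective {A = Fin k} _≡_ _≡_ f × (∀ i → f i ≢ i)
derangement {suc (suc k)} _ = shift , shift-injective , shift-≢
  where
  shift : Fin (2 + k) → Fin (2 + k)
  shift zero    = fromℕ (suc k)
  shift (suc i) = inject₁ i
  shift-injective : Injective _≡_ _≡_ shift
  shift-injective {zero}  {zero}  _  = refl
  shift-injective {zero}  {suc j} eq = contradiction eq fromℕ≢inject₁
  shift-injective {suc i} {zero}  eq = contradiction (sym eq) fromℕ≢inject₁
  shift-injective {suc i} {suc j} eq = cong suc (inject₁-injective eq)
  shift-≢ : ∀ i → shift i ≢ i
  shift-≢ zero    ()
  shift-≢ (suc i) eq = 1+n≢n (trans (sym (cong toℕ eq)) (toℕ-inject₁ i))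
derangement {suc zero} (s≤s ())

-- Colourings

module _ {G : Graph (Fin n)} where

  colouring-ext : {c d : Colouring k G} → (∀ v → colour c v ≡ colour d v) → c ≡ d
  colouring-ext {c = mkColouring cs _} {mkColouring ds _} eq
    with refl ← Pointwise-≡⇒≡ {xs = cs} {ds} (ext eq) = refl

  -- Properness is stored irrelevantly; being a negation, it can be recomputed.
  proper : (c : Colouring k G) → ∀ {u v} → Adj G u v → colour c u ≢ colour c v
  proper (mkColouring _ p) uv = ¬-recompute (p uv)

  fromFunction : (f : Fin n → Fin k) → (∀ u v → Adj G u v → f u ≢ f v) → Colouring k G
  fromFunction f p = mkColouring (tabulateᵛ f) λ {u} {v} uv eq →
    p u v uv (trans (sym (lookup∘tabulate f u)) (trans eq (lookup∘tabulate f v)))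

  recolour : (c : Colouring k G) (v : Fin n) (a : Fin k) →
    (∀ w → Adj G v w → colour c w ≢ a) → Colouring k G
  recolour c v a free = mkColouring (colours c [ v ]≔ a) prop
    where
    changed   = lookup∘update v (colours c) a
    unchanged : ∀ {w} → w ≢ v → lookupᵛ (colours c [ v ]≔ a) w ≡ colour c w
    unchanged w≢v = lookup∘update′ w≢v (colours c) a
    prop : ∀ {s t} → Adj G s t →
      lookupᵛ (colours c [ v ]≔ a) s ≢ lookupᵛ (colours c [ v ]≔ a) t
    prop {s} {t} st eq with s ≟ v | t ≟ v
    ... | yes refl | yes refl = adj-irrefl G st
    ... | yes refl | no t≢v   = free t st
      (trans (sym (unchanged t≢v)) (trans (sym eq) changed))
    ... | no s≢v   | yes refl = free s (adj-sym G st)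
      (trans (sym (unchanged s≢v)) (trans eq changed))
    ... | no s≢v   | no t≢v   = proper c st
      (trans (sym (unchanged s≢v)) (trans eq (unchanged t≢v)))

  -- A record, so that unification recovers `v`, `c` and `d` from the type of a proof.
  record AgreeOff (v : Fin n) (c d : Colouring k G) : Set where
    constructor agreeOff
    field
      agree : ∀ {w} → w ≢ v → colour c w ≡ colour d w

  Recolours : Colouring k G → Colouring k G → Fin n → Set
  Recolours c d v = DifferAt c d v × AgreeOff v c d

  recolours⇒adj : {c d : Colouring k G} {v : Fin n} → Recolours c d v → DifferAtExactlyOne c d
  recolours⇒adj {v = v} (c≢d , agreeOff eq) = v , c≢d ,
    λ {w} c≢d′ → decidable-stable (v ≟ w) λ v≢w → c≢d′ (eq (v≢w ∘ sym))

  adj⇒recolours : (c d : Colouring k G) → DifferAtExactlyOne c d → ∃ (Recolours c d)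
  adj⇒recolours c d (v , c≢d , unique) = v , c≢d , agreeOff
    λ {w} w≢v → decidable-stable (colour c w ≟ colour d w) λ c≢d′ → w≢v (sym (unique c≢d′))

  recolour-recolours : (c : Colouring k G) (v : Fin n) (a : Fin k) →
    (free : ∀ w → Adj G v w → colour c w ≢ a) → colour c v ≢ a → Recolours c (recolour c v a free) v
  recolour-recolours c v a free c≢a =
    (λ p → c≢a (trans p (lookup∘update v (colours c) a))) ,
    agreeOff λ w≢v → sym (lookup∘update′ w≢v (colours c) a)

-- Reflexive closure of adjacency: two recolourings of one vertex may coincide, and walks may pause.
data AdjOrEq {V : Set} (G : Graph V) (u : V) : V → Set where
  equal    : AdjOrEq G u u
  adjacent : ∀ {v} → Adj G u v → AdjOrEq G u v

≅-adjOrEq : {V W : Set} {G : Graph V} {H : Graph W} (φ : G ≅ H) → ∀ {u v} →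
  AdjOrEq G u v → AdjOrEq H (to (_≅_.bijection φ) u) (to (_≅_.bijection φ) v)
≅-adjOrEq φ equal         = equal
≅-adjOrEq φ (adjacent uv) = adjacent (Equivalence.to (_≅_.adjacency φ _ _) uv)

-- Cliques and common neighbours around a colouring

module _ {G : Graph (Fin n)} {c x y : Colouring k G} where

  same-vertex⇒adjOrEq : ∀ {v} → AgreeOff v c x → AgreeOff v c y → AdjOrEq (𝒞 k G) x y
  same-vertex⇒adjOrEq {v} (agreeOff cx) (agreeOff cy) with colour x v ≟ colour y v
  ... | no x≢y = adjacent (recolours⇒adj x⇝y)
    where
    x⇝y : Recolours x y v
    x⇝y = x≢y , agreeOff λ w≢v → trans (sym (cx w≢v)) (cy w≢v)
  ... | yes x≡y = subst (AdjOrEq (𝒞 _ G) x) (colouring-ext agree) equal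
    where
    agree : ∀ w → colour x w ≡ colour y w
    agree w with w ≟ v
    ... | yes refl = x≡y
    ... | no w≢v = trans (sym (cx w≢v)) (cy w≢v)

  -- Were `u` and `v` distinct, `x` and `y` would differ at both: at each, one has left the colour
  -- of `c` and the other has kept it.
  adjOrEq⇒same-vertex : ∀ {u v} → Recolours c x u → Recolours c y v →
    AdjOrEq (𝒞 k G) x y → u ≡ v
  adjOrEq⇒same-vertex {u} {v} (c≢x , agreeOff cx) (c≢y , agreeOff cy) xy with u ≟ v
  ... | yes u≡v = u≡v
  ... | no u≢v with xy
  ...   | equal = contradiction (cy u≢v) c≢x
  ...   | adjacent (_ , _ , unique) = trans
    (sym (unique {u} λ p → c≢x (trans (cy u≢v) (sym p))))
    (unique {v} λ p → c≢y (trans (cx (u≢v ∘ sym)) p))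

  -- A common neighbour must undo the change at `u` from `x` and the change at `v` from `y`, which
  -- leads back to `c`.
  adjacent⇒unique-common-neighbour : ∀ {u v z} → Adj G u v →
    Recolours c x u → Recolours c y v → colour x u ≡ colour y v →
    Adj (𝒞 k G) x z → Adj (𝒞 k G) y z → z ≡ c
  adjacent⇒unique-common-neighbour {u} {v} {z} uv (c≢x , agreeOff cx) (c≢y , agreeOff cy) x≡y xz yz
    with s , _ , agreeOff xz′ ← adj⇒recolours x z xz
    with t , _ , agreeOff yz′ ← adj⇒recolours y z yz
    = colouring-ext agree
    where
    u≢v : u ≢ v
    u≢v refl = adj-irrefl G uv
    s≡u : s ≡ u
    -- Otherwise `z` keeps the shared colour at `u`, which forces `t` to be `u`, so `z` has that
    -- colour at `v` too, against the edge `uv`.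
    s≡u = decidable-stable (s ≟ u) λ s≢u →
      let zu = xz′ (s≢u ∘ sym)
          u≡t = decidable-stable (u ≟ t) λ u≢t → c≢x (trans (cy u≢v) (trans (yz′ u≢t) (sym zu)))
          zv = yz′ (λ v≡t → u≢v (trans u≡t (sym v≡t)))
      in proper z uv (trans (sym zu) (trans x≡y zv))
    t≡v : t ≡ v
    t≡v = decidable-stable (t ≟ v) λ t≢v →
      c≢y (trans (cx (u≢v ∘ sym))
        (trans (xz′ (λ v≡s → u≢v (sym (trans v≡s s≡u)))) (sym (yz′ (t≢v ∘ sym)))))
    agree : ∀ w → colour z w ≡ colour c w
    agree w with w ≟ u
    ... | yes refl = trans (sym (yz′ (λ u≡t → u≢v (trans u≡t t≡v)))) (sym (cy u≢v))
    ... | no w≢u = trans (sym (xz′ (λ w≡s → w≢u (trans w≡s s≡u)))) (sym (cx w≢u))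

  -- The witness carries both changes: it is `y` with `u` given its colour in `x`.
  nonadjacent⇒second-common-neighbour : ∀ {u v} → u ≢ v → ¬ Adj G u v →
    Recolours c x u → Recolours c y v →
    ∃[ z ] Adj (𝒞 k G) x z × Adj (𝒞 k G) y z × z ≢ c
  nonadjacent⇒second-common-neighbour {u} {v} u≢v ¬uv (c≢x , agreeOff cx) (c≢y , agreeOff cy) =
    z , recolours⇒adj x⇝z , recolours⇒adj yz , λ { refl → c≢x zu }
    where
    free : ∀ w → Adj G u w → colour y w ≢ colour x u
    -- A neighbour of `u` is neither `u` nor `v`, so its colour is the same in `x`, `y` and `c`, and
    -- properness of `x` applies.
    free w uw eq = proper x uw (trans (sym eq) (trans (sym (cy w≢v)) (cx w≢u)))
      where
      w≢v : w ≢ v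
      w≢v refl = ¬uv uw
      w≢u : w ≢ u
      w≢u refl = adj-irrefl G uw
    z = recolour y u (colour x u) free
    yz : Recolours y z u
    yz = recolour-recolours y u (colour x u) free λ p → c≢x (trans (cy u≢v) p)
    zu : colour z u ≡ colour x u
    zu = lookup∘update u (colours y) (colour x u)
    x⇝z : Recolours x z v
    x⇝z = x≢z , agreeOff xz
      where
      x≢z : DifferAt x z v
      x≢z p = c≢y (trans (cx (u≢v ∘ sym)) (trans p (sym (AgreeOff.agree (proj₂ yz) (u≢v ∘ sym)))))
      xz : ∀ {w} → w ≢ v → colour x w ≡ colour z w
      xz {w} w≢v with w ≟ u
      ... | yes refl = sym zu
      ... | no w≢u = trans (sym (cx w≢u)) (trans (cy w≢v) (AgreeOff.agree (proj₂ yz) w≢u))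

-- The isomorphism around one colouring

module _ {G : Graph (Fin n)} {H : Graph (Fin m)} (φ : 𝒞 k G ≅ 𝒞 k H) where
  open _≅_ φ renaming (bijection to f)

  -- If `s` and `t` were nonadjacent, a second common neighbour of the images would pull back to one
  -- of `x` and `y`, hence to `c`. The shared colour is assumed on the source side only, so the
  -- converse follows from the inverse isomorphism.
  adjacency-preserved : ∀ {c d x y u v s t} → to f c ≡ d →
    Recolours c x u → Recolours c y v → colour x u ≡ colour y v →
    Recolours d (to f x) s → Recolours d (to f y) t → Adj G u v → Adj H s t
  adjacency-preserved {c} {d} {x} {y} {u} {v} {s} {t} refl cx cy x≡y dx dy uv =
    decidable-stable (adj? H s t) λ ¬st →
      let z , xz , yz , z≢d = nonadjacent⇒second-common-neighbour s≢t ¬st dx dy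
      in z≢d (trans (sym (strictlyInverseˡ f z)) (cong (to f)
           (adjacent⇒unique-common-neighbour uv cx cy x≡y (pull x z xz) (pull y z yz))))
    where
    pull : ∀ x z → Adj (𝒞 k H) (to f x) z → Adj (𝒞 k G) x (from f z)
    pull x z xz = Equivalence.from (adjacency x (from f z))
      (subst (Adj (𝒞 k H) (to f x)) (sym (strictlyInverseˡ f z)) xz)
    s≢t : s ≢ t
    -- Images changing the same vertex are equal or adjacent, hence so are `x` and `y`, and `uv`
    -- would be a loop.
    s≢t refl = adj-irrefl G (subst (Adj G u) (sym u≡v) uv)
      where
      u≡v : u ≡ v
      u≡v = adjOrEq⇒same-vertex cx cy
        (subst₂ (AdjOrEq (𝒞 k G)) (strictlyInverseʳ f x) (strictlyInverseʳ f y)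
          (≅-adjOrEq (≅-sym φ) (same-vertex⇒adjOrEq (proj₂ dx) (proj₂ dy))))

  -- The centre `d` is given by an equation because `from f (to f c)` equals `c` only
  -- propositionally.
  imageVertex : ∀ {c d x v} → to f c ≡ d → Recolours c x v → ∃ (Recolours d (to f x))
  imageVertex {c} {x = x} refl cx =
    adj⇒recolours (to f c) (to f x) (Equivalence.to (adjacency c x) (recolours⇒adj cx))

  -- `y` lies in the clique of the image of `x`, so its preimage lies in the clique of `x`. This
  -- makes the two vertex maps mutually inverse.
  imageVertex-inverse : ∀ {c d x y v w} → to f c ≡ d → Recolours c x v →
    Recolours d (to f x) w → AgreeOff w d y → ∀ {v′} → Recolours c (from f y) v′ → v′ ≡ v
  imageVertex-inverse {x = x} refl cx dx dy cy = adjOrEq⇒same-vertex cy cx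
    (subst (AdjOrEq (𝒞 k G) _) (strictlyInverseʳ f x)
      (≅-adjOrEq (≅-sym φ) (same-vertex⇒adjOrEq dy (proj₂ dx))))

unusedColour : {G : Graph (Fin n)} → n < k → (c : Colouring k G) →
  ∃[ a ] (∀ v → colour c v ≢ a)
unusedColour n<k c
  with a , a∉ ← fresh (tabulate (colour c)) (subst (_< _) (sym (length-tabulate (colour c))) n<k)
  = a , λ { v refl → a∉ (∈-tabulate⁺ v) }

-- `φ` need not carry the family `x` to the family `y`; only the cliques containing them correspond,
-- so `a` and `b` are chosen independently.
reconstruction : {G : Graph (Fin n)} {H : Graph (Fin m)} → n < k → m < k →
  Colouring k G → 𝒞 k G ≅ 𝒞 k H → G ≅ H
reconstruction {n} {m} {k} {G} {H} n<k m<k c φ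
  with a , a-unused ← unusedColour n<k c
  with b , b-unused ← unusedColour m<k (to (_≅_.bijection φ) c)
  = record
  { bijection = mk↔ₛ′ β γ
      (λ w → imageVertex-inverse (≅-sym φ) d↦c (dy w) (cy w) (proj₂ (cx (γ w))) (dx (γ w)))
      (λ v → imageVertex-inverse φ refl (cx v) (dx v) (proj₂ (dy (β v))) (cy (β v)))
  ; adjacency = λ u v → mk⇔
      (adjacency-preserved φ refl (cx u) (cx v) (trans (xa u) (sym (xa v))) (dx u) (dx v))
      -- The inverse isomorphism is applied to the recolourings of `β u` and `β v` by `b`.
      (subst₂ (Adj G) (γβ u) (γβ v) ∘
        adjacency-preserved (≅-sym φ) d↦c (dy _) (dy _) (trans (yb _) (sym (yb _))) (cy _) (cy _))
  }
  where
  f = _≅_.bijection φ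
  d = to f c
  d↦c : from f d ≡ c
  d↦c = strictlyInverseʳ f c
  x : Fin n → Colouring k G
  x v = recolour c v a λ w _ → a-unused w
  y : Fin m → Colouring k H
  y w = recolour d w b λ v _ → b-unused v
  xa : ∀ v → colour (x v) v ≡ a
  xa v = lookup∘update v (colours c) a
  yb : ∀ w → colour (y w) w ≡ b
  yb w = lookup∘update w (colours d) b
  cx : ∀ v → Recolours c (x v) v
  cx v = recolour-recolours c v a (λ w _ → a-unused w) (a-unused v)
  dy : ∀ w → Recolours d (y w) w
  dy w = recolour-recolours d w b (λ v _ → b-unused v) (b-unused w)
  β : Fin n → Fin m
  β v = proj₁ (imageVertex φ refl (cx v))
  γ : Fin m → Fin n
  γ w = proj₁ (imageVertex (≅-sym φ) d↦c (dy w))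
  dx : ∀ v → Recolours d (to f (x v)) (β v)
  dx v = proj₂ (imageVertex φ refl (cx v))
  cy : ∀ w → Recolours c (from f (y w)) (γ w)
  cy w = proj₂ (imageVertex (≅-sym φ) d↦c (dy w))
  γβ : ∀ v → γ (β v) ≡ v
  γβ v = imageVertex-inverse φ refl (cx v) (dx v) (proj₂ (dy (β v))) (cy (β v))

-- Distances in the colouring graph

data Walk {V : Set} (G : Graph V) : ℕ → V → V → Set where
  []  : ∀ {u} → Walk G 0 u u
  _∷_ : ∀ {u v w l} → AdjOrEq G u v → Walk G l v w → Walk G (suc l) u w

_++ʷ_ : {V : Set} {G : Graph V} {u v w : V} {l l′ : ℕ} →
  Walk G l u v → Walk G l′ v w → Walk G (l + l′) u w
[]      ++ʷ q = q
(e ∷ p) ++ʷ q = e ∷ (p ++ʷ q)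

mapWalk : {V W : Set} {G : Graph V} {H : Graph W} (φ : G ≅ H) → ∀ {l u v} → Walk G l u v →
  Walk H l (to (_≅_.bijection φ) u) (to (_≅_.bijection φ) v)
mapWalk φ []      = []
mapWalk φ (e ∷ p) = ≅-adjOrEq φ e ∷ mapWalk φ p

-- The list collects the vertex changed by each nontrivial step; the endpoints can differ only
-- there.
walk-support : {G : Graph (Fin n)} {l : ℕ} {c d : Colouring k G} → Walk (𝒞 k G) l c d →
  ∃[ vs ] length vs ≤ l × (∀ v → DifferAt c d v → v ∈ vs)
walk-support [] = [] , z≤n , λ v c≢c → contradiction refl c≢c
walk-support (equal ∷ p) with vs , le , covers ← walk-support p =
  vs , m≤n⇒m≤1+n le , covers
walk-support {c = c} {d} (_∷_ {v = x} (adjacent (u , _ , unique)) p)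
  with vs , le , covers ← walk-support p = u ∷ vs , s≤s le , covers′
  where
  covers′ : ∀ v → DifferAt c d v → v ∈ u ∷ vs
  covers′ v c≢d with colour x v ≟ colour d v
  ... | no x≢d  = there (covers v x≢d)
  -- The rest of the walk leaves no difference at `v`, so the first step made it.
  ... | yes x≡d = here (sym (unique λ q → c≢d (trans q x≡d)))

order≤walk : {G : Graph (Fin n)} {l : ℕ} {c d : Colouring k G} →
  (∀ v → DifferAt c d v) → Walk (𝒞 k G) l c d → n ≤ l
order≤walk c≢d p with vs , le , covers ← walk-support p =
  ≤-trans (covering⇒≤length vs λ v → covers v (c≢d v)) le

module _ {G : Graph (Fin n)} where

  -- Vertices switch from `c` to `d` one at a time. The mixtures stay proper because no colour of
  -- `c` occurs in `d`.
  disjoint⇒walk : (c d : Colouring k G) → (∀ u v → colour c u ≢ colour d v) →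
    Walk (𝒞 k G) n c d
  disjoint⇒walk {k} c d disjoint =
    subst₂ (λ l e → Walk (𝒞 k G) l e d) (length-tabulate {n = n} (λ v → v))
      (colouring-ext λ v → trans (lookup∘tabulate (mixed (allFin n)) v)
                                 (mixed-∈ (allFin n) (∈-allFin v)))
      (walk (allFin n))
    where
    mixed : List (Fin n) → Fin n → Fin k
    mixed vs v with _∈?_ _≟_ v vs
    ... | yes _ = colour c v
    ... | no  _ = colour d v

    mixed-∈ : ∀ vs {v} → v ∈ vs → mixed vs v ≡ colour c v
    mixed-∈ vs {v} v∈ with _∈?_ _≟_ v vs
    ... | yes _  = refl
    ... | no v∉ = contradiction v∈ v∉

    mixed-∷ : ∀ v vs {w} → w ≢ v → mixed (v ∷ vs) w ≡ mixed vs w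
    mixed-∷ v vs {w} w≢v with w ≟ v | _∈?_ _≟_ w vs
    ... | yes w≡v | _     = contradiction w≡v w≢v
    ... | no _    | yes _ = refl
    ... | no _    | no _  = refl

    mixed-proper : ∀ vs u v → Adj G u v → mixed vs u ≢ mixed vs v
    mixed-proper vs u v uv with _∈?_ _≟_ u vs | _∈?_ _≟_ v vs
    ... | yes _ | yes _ = proper c uv
    ... | yes _ | no _  = disjoint u v
    ... | no _  | yes _ = disjoint v u ∘ sym
    ... | no _  | no _  = proper d uv

    mixture : List (Fin n) → Colouring k G
    mixture vs = fromFunction (mixed vs) (mixed-proper vs)

    mixture-∷ : ∀ v vs → AgreeOff v (mixture (v ∷ vs)) (mixture vs)
    mixture-∷ v vs = agreeOff λ {w} w≢v → trans (lookup∘tabulate (mixed (v ∷ vs)) w)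
      (trans (mixed-∷ v vs w≢v) (sym (lookup∘tabulate (mixed vs) w)))

    walk : ∀ vs → Walk (𝒞 k G) (length vs) (mixture vs) d
    walk []       = subst (Walk (𝒞 k G) 0 (mixture []))
      (colouring-ext (lookup∘tabulate (mixed []))) []
    walk (v ∷ vs) =
      same-vertex⇒adjOrEq {v = v} (agreeOff λ _ → refl) (mixture-∷ v vs) ∷ walk vs

  colouringAvoiding : (xs : List (Fin k)) → n + length xs ≤ k →
    ∃[ c ] (∀ v → colour {G = G} c v ∉ xs)
  colouringAvoiding xs le with f , inj , avoid ← freshInjection n xs le =
    fromFunction f prop ,
    λ v → avoid v ∘ subst (_∈ xs) (lookup∘tabulate f v)
    where
    prop : ∀ u v → Adj G u v → f u ≢ f v
    prop u v uv fu≡fv = adj-irrefl G (subst (Adj G u) (sym (inj fu≡fv)) uv)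

  -- The midpoint `e` avoids the at most `n + n` colours of `c` and `d`; another `n` colours let it
  -- be injective, hence proper.
  walk-2n : n + (n + n) ≤ k → (c d : Colouring k G) → Walk (𝒞 k G) (n + n) c d
  walk-2n {k} le c d =
    let e , avoid = colouringAvoiding xs (subst (λ l → n + l ≤ k) (sym length-xs) le)
    in disjoint⇒walk c e
         (λ u v c≡e → avoid v (subst (_∈ xs) c≡e (∈-++⁺ˡ (∈-tabulate⁺ u))))
       ++ʷ disjoint⇒walk e d
         (λ u v e≡d → avoid u (subst (_∈ xs) (sym e≡d) (∈-++⁺ʳ cs (∈-tabulate⁺ v))))
    where
    cs = tabulate (colour c)
    xs = cs ++ tabulate (colour d)
    length-xs : length xs ≡ n + n
    length-xs = trans (length-++ cs)
      (cong₂ _+_ (length-tabulate (colour c)) (length-tabulate (colour d)))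

-- Permuting the colours of `c` by a derangement changes every vertex, while a walk between the
-- images in `𝒞 k G` pulls back with its length.
order≤2·order : {G : Graph (Fin n)} {H : Graph (Fin m)} → 2 ≤ k → n + (n + n) ≤ k →
  Colouring k H → 𝒞 k H ≅ 𝒞 k G → m ≤ n + n
order≤2·order {k = k} {H = H} 2≤k le c φ
  with σ , σ-injective , σ-≢ ← derangement 2≤k = order≤walk c≢d
    (subst₂ (Walk (𝒞 k H) _) (strictlyInverseʳ f c) (strictlyInverseʳ f d)
      (mapWalk (≅-sym φ) (walk-2n le (to f c) (to f d))))
  where
  f = _≅_.bijection φ
  d : Colouring k H
  d = fromFunction (σ ∘ colour c) λ u v uv → proper c uv ∘ σ-injective
  c≢d : ∀ v → DifferAt c d v
  c≢d v eq = σ-≢ (colour c v)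
    (sym (trans eq (lookup∘tabulate (σ ∘ colour c) v)))

theorem4 : (n : ℕ) → n ≥ 1 → (G : Graph (Fin n)) →
    (k : ℕ) → k > 5 * n ^ 2 →
    (n' : ℕ) → n' ≥ 1 → (G' : Graph (Fin n')) →
    𝒞 k G' ≅ 𝒞 k G → G' ≅ G
theorem4 n@(suc _) n≥1 G k k>5n² n' _ G' φ =
  reconstruction (≤-<-trans n'≤2n (≤-<-trans (m≤n+m (n + n) n) 3n<k)) n<k c' φ
  where
  3n<k : n + (n + n) < k
  3n<k = ≤-<-trans (begin
    n + (n + n)       ≡⟨ cong (λ l → n + (n + l)) (+-identityʳ n) ⟨
    3 * n             ≤⟨ *-monoˡ-≤ n (m≤m+n 3 2) ⟩
    5 * n             ≤⟨ *-monoʳ-≤ 5 (m≤m*n n (n ^ 1)) ⟩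
    5 * n ^ 2         ∎) k>5n²
    where open ≤-Reasoning
  n<k : n < k
  n<k = ≤-<-trans (m≤m+n n (n + n)) 3n<k
  -- Since `n'` is not yet known to be below `k`, a colouring of `G'` is obtained from one of `G`.
  c' : Colouring k G'
  c' = from (_≅_.bijection φ)
    (proj₁ (colouringAvoiding [] (≤-trans (+-monoʳ-≤ n z≤n) (<⇒≤ 3n<k))))
  n'≤2n : n' ≤ n + n
  -- From `1 ≤ n < k` come the two colours required by the derangement.
  n'≤2n = order≤2·order (≤-<-trans n≥1 n<k) (<⇒≤ 3n<k) c' φ
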